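{- For any abstract factorial $!_{a}$, the number $e_{a} = \sum_{n=0}^{\infty} \frac{1}{n!_{a}}$ is irrational. In fact, if $k \geq 1$, $!_{a_1}, !_{a_2}, \dots, !_{a_k}$ is any collection of abstract factorials, and $s_1, \dots, s_k \in \mathbb{N}$ are not all equal to zero, then $$\sum_{n=0}^{\infty} \frac{1}{\prod_{j=1}^{k} (n!_{a_j})^{s_j}}$$ is irrational.
   Context: $\mathbb{N}=\{0,1,2,\dots\}$ and $\mathbb{Z}^+=\{1,2,3,\dots\}$. An abstract factorial (also called a factorial function) is a function $!_{a}:\mathbb{N}\to\mathbb{Z}^+$, $n\mapsto n!_{a}$, such that: (1) $0!_{a}=1$; (2) for all integers $0\le k\le n$, the generalized binomial coefficient $\binom{n}{k}_{a}:=\frac{n!_{a}}{k!_{a}\,(n-k)!_{a}}$ is a positive integer; (3) for every positive integer $n$, the ordinary factorial $n!$ divides $n!_{a}$. -}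

module Defs where

open import Data.Fin.Base using (Fin; zero; suc)
open import Data.Integer.Base using (+_)
open import Data.Nat.Base as ℕ using (ℕ; zero; suc; NonZero; _∸_; _^_; _!)
import Data.Nat.Divisibility as ℕ
import Data.Nat.Properties as ℕ
open import Data.Product.Base using (∃-syntax; _×_; _,_)
open import Data.Rational.Base using (ℚ; 0ℚ; ½; _/_; _+_; _*_; _-_; -_; ∣_∣; _<_; _≤_)
open import Data.Rational.Properties
open import Data.Rational.Solver using (module +-*-Solver)
open import Data.Sum.Base using (_⊎_; inj₁; inj₂)
open import Data.Vec.Functional using (foldr)
open import Relation.Binary.PropositionalEquality
  using (_≡_; refl; sym; trans; cong; subst; subst₂)
open import Relation.Nullary using (¬_)

IsPositiveInteger : ℚ → Set
IsPositiveInteger q = ∃[ m ] (0 ℕ.< m × q ≡ + m / 1)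

record AbstractFactorial : Set where
  field
    fac     : ℕ → ℕ
    nonZero : ∀ n → NonZero (fac n)

  binomial : ℕ → ℕ → ℚ
  binomial n k = (+ fac n / (fac k ℕ.* fac (n ∸ k)))
    {{ℕ.m*n≢0 _ _ {{nonZero k}} {{nonZero (n ∸ k)}}}}

  field
    fac-zero          : fac 0 ≡ 1
    binomial-integral : ∀ n k → k ℕ.≤ n → IsPositiveInteger (binomial n k)
    !-divides         : ∀ n → 0 ℕ.< n → (n !) ℕ.∣ fac n

open AbstractFactorial public using (fac; nonZero)

-- The reals are Cauchy sequences of rationals, with _≃_ as their equality.

IsCauchy : (ℕ → ℚ) → Set
IsCauchy u = ∀ ε → 0ℚ < ε →
  ∃[ N ] (∀ m n → N ℕ.≤ m → N ℕ.≤ n → ∣ u m - u n ∣ < ε)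

record ℝ : Set where
  constructor mkℝ
  field
    seq    : ℕ → ℚ
    cauchy : IsCauchy seq

open ℝ public

infix 4 _≃_ _<ʳ_
infixl 6 _-ʳ_

_≃_ : ℝ → ℝ → Set
x ≃ y = ∀ ε → 0ℚ < ε → ∃[ N ] (∀ n → N ℕ.≤ n → ∣ seq x n - seq y n ∣ < ε)

_<ʳ_ : ℝ → ℝ → Set
x <ʳ y = ∃[ δ ] (0ℚ < δ × ∃[ N ] (∀ n → N ℕ.≤ n → seq x n + δ ≤ seq y n))

fromℚ : ℚ → ℝ
fromℚ q = mkℝ (λ _ → q) λ ε 0<ε → 0 , λ _ _ _ _ →
  subst (λ p → ∣ p ∣ < ε) (sym (+-inverseʳ q)) 0<ε

private
  half+half : ∀ p → p * ½ + p * ½ ≡ p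
  half+half p = trans (sym (*-distribˡ-+ p ½ ½)) (*-identityʳ p)

  0<half : ∀ p → 0ℚ < p → 0ℚ < p * ½
  0<half p 0<p = subst (_< p * ½) (*-zeroˡ ½) (*-monoˡ-<-pos ½ 0<p)

  interchange : ∀ a b c d → (a - b) - (c - d) ≡ (a - c) - (b - d)
  interchange = solve 4 (λ a b c d → (a :- b) :- (c :- d) := (a :- c) :- (b :- d)) refl
    where open +-*-Solver

  ∣∣p∣-∣q∣∣≤∣p-q∣ : ∀ p q → ∣ ∣ p ∣ - ∣ q ∣ ∣ ≤ ∣ p - q ∣
  ∣∣p∣-∣q∣∣≤∣p-q∣ p q = go (∣p∣≡p∨∣p∣≡-p (∣ p ∣ - ∣ q ∣))
    where
    open +-*-Solver

    p-q+q : ∀ p q → (p - q) + q ≡ p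
    p-q+q = solve 2 (λ p q → (p :- q) :+ q := p) refl

    p+q-q : ∀ p q → (p + q) - q ≡ p
    p+q-q = solve 2 (λ p q → (p :+ q) :- q := p) refl

    neg-sub : ∀ p q → - (p - q) ≡ q - p
    neg-sub = solve 2 (λ p q → :- (p :- q) := q :- p) refl

    one-sided : ∀ p q → ∣ p ∣ - ∣ q ∣ ≤ ∣ p - q ∣
    one-sided p q = begin
      ∣ p ∣ - ∣ q ∣                  ≡⟨ cong (λ t → ∣ t ∣ - ∣ q ∣) (p-q+q p q) ⟨
      ∣ (p - q) + q ∣ - ∣ q ∣        ≤⟨ +-monoˡ-≤ (- ∣ q ∣) (∣p+q∣≤∣p∣+∣q∣ (p - q) q) ⟩
      (∣ p - q ∣ + ∣ q ∣) - ∣ q ∣    ≡⟨ p+q-q ∣ p - q ∣ ∣ q ∣ ⟩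
      ∣ p - q ∣                      ∎
      where open ≤-Reasoning

    ∣q-p∣≡∣p-q∣ : ∣ q - p ∣ ≡ ∣ p - q ∣
    ∣q-p∣≡∣p-q∣ = trans (cong ∣_∣ (sym (neg-sub p q))) (∣-p∣≡∣p∣ (p - q))

    go : ∣ ∣ p ∣ - ∣ q ∣ ∣ ≡ ∣ p ∣ - ∣ q ∣ ⊎ ∣ ∣ p ∣ - ∣ q ∣ ∣ ≡ - (∣ p ∣ - ∣ q ∣) →
         ∣ ∣ p ∣ - ∣ q ∣ ∣ ≤ ∣ p - q ∣
    go (inj₁ e) = subst (_≤ ∣ p - q ∣) (sym e) (one-sided p q)
    go (inj₂ e) = subst₂ _≤_ (sym (trans e (neg-sub ∣ p ∣ ∣ q ∣))) ∣q-p∣≡∣p-q∣ (one-sided q p)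

_-ʳ_ : ℝ → ℝ → ℝ
x -ʳ y = mkℝ (λ n → seq x n - seq y n) λ ε 0<ε →
  let M , hx = cauchy x (ε * ½) (0<half ε 0<ε)
      N , hy = cauchy y (ε * ½) (0<half ε 0<ε)
  in M ℕ.+ N , λ m n m≥ n≥ →
    let a = seq x m ; b = seq y m ; c = seq x n ; d = seq y n
        M≤ = ℕ.m≤m+n M N ; N≤ = ℕ.m≤n+m N M
    in begin-strict
      ∣ (a - b) - (c - d) ∣    ≡⟨ cong ∣_∣ (interchange a b c d) ⟩
      ∣ (a - c) - (b - d) ∣    ≤⟨ ∣p-q∣≤∣p∣+∣q∣ (a - c) (b - d) ⟩
      ∣ a - c ∣ + ∣ b - d ∣    <⟨ +-mono-< (hx m n (ℕ.≤-trans M≤ m≥) (ℕ.≤-trans M≤ n≥))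
                                           (hy m n (ℕ.≤-trans N≤ m≥) (ℕ.≤-trans N≤ n≥)) ⟩
      ε * ½ + ε * ½            ≡⟨ half+half ε ⟩
      ε                        ∎
  where open ≤-Reasoning

∣_∣ʳ : ℝ → ℝ
∣ x ∣ʳ = mkℝ (λ n → ∣ seq x n ∣) λ ε 0<ε →
  let N , h = cauchy x ε 0<ε
  in N , λ m n m≥ n≥ → ≤-<-trans (∣∣p∣-∣q∣∣≤∣p-q∣ (seq x m) (seq x n)) (h m n m≥ n≥)

-- Rational ε suffice: every positive real exceeds a positive rational.
_ConvergesTo_ : (ℕ → ℝ) → ℝ → Set
u ConvergesTo x = ∀ ε → 0ℚ < ε →
  ∃[ N ] (∀ n → N ℕ.≤ n → ∣ u n -ʳ x ∣ʳ <ʳ fromℚ ε)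

partialSum : (ℕ → ℚ) → ℕ → ℚ
partialSum t zero    = 0ℚ
partialSum t (suc n) = partialSum t n + t n

_SumsTo_ : (ℕ → ℚ) → ℝ → Set
t SumsTo x = (λ n → fromℚ (partialSum t n)) ConvergesTo x

Irrational : ℝ → Set
Irrational x = ¬ (∃[ q ] x ≃ fromℚ q)

-- Limits are unique up to _≃_, and Irrational respects _≃_, so the choice of
-- x is immaterial; its existence asserts that the series converges.
HasIrrationalSum : (ℕ → ℚ) → Set
HasIrrationalSum t = ∃[ x ] (t SumsTo x × Irrational x)

∏ : ∀ {k} → (Fin k → ℕ) → ℕ
∏ = foldr ℕ._*_ 1

∏-nonZero : ∀ {k} (f : Fin k → ℕ) → (∀ j → NonZero (f j)) → NonZero (∏ f)
∏-nonZero {zero}  f f≢0 = _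
∏-nonZero {suc k} f f≢0 = ℕ.m*n≢0 _ _
  {{f≢0 zero}} {{∏-nonZero (λ j → f (suc j)) (λ j → f≢0 (suc j))}}

reciprocal : AbstractFactorial → ℕ → ℚ
reciprocal a n = (+ 1 / fac a n) {{nonZero a n}}

productReciprocal : ∀ {k} → (Fin k → AbstractFactorial) → (Fin k → ℕ) → ℕ → ℚ
productReciprocal a s n = (+ 1 / ∏ (λ j → fac (a j) n ^ s j))
  {{∏-nonZero _ (λ j → ℕ.m^n≢0 (fac (a j) n) (s j) {{nonZero (a j) n}})}}

{-# OPTIONS --safe #-}
module Submission where

-- If g m ∣ g n for m ≤ n and n ! ≤ g n, then Σ 1 / g n is irrational: suppose it is q, with denominator b,
-- and let R n = q - Σ_{m<n} 1 / g m.  Then b (g n) R (n + 1) is a positive integer, so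
-- R n - R (n + 1) = 1 / g n ≤ b R (n + 1), that is R n ≤ (b + 1) R (n + 1): the tails decay at most
-- geometrically.  But n ! ≤ g n makes them at most 2 / n !.

open import Defs
open import Data.Fin.Base using (Fin; zero; suc)
open import Data.Fin.Properties using (¬∀⟶∃¬)
open import Data.Integer.Base as ℤ using (+_)
import Data.Integer.Properties as ℤ
open import Data.Nat.Base as ℕ using (ℕ; zero; suc; NonZero; _≤_; _^_; _!; z≤n; s≤s)
open import Data.Nat.Divisibility as ℕ using (_∣_; divides)
import Data.Nat.Properties as ℕ
open import Data.Nat.Solver using (module +-*-Solver)
open import Data.Product.Base using (_×_; _,_; ∃-syntax)
open import Data.Rational.Base as ℚ
  using (ℚ; mkℚ; 0ℚ; 1ℚ; ½; _/_; _+_; _*_; _-_; -_; ∣_∣; ↥_; ↧ₙ_; toℚᵘ; fromℚᵘ)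
import Data.Rational.Properties as ℚ
import Data.Rational.Solver as ℚ
open import Data.Rational.Unnormalised.Base as ℚᵘ using (mkℚᵘ; *≡*; *≤*)
import Data.Rational.Unnormalised.Properties as ℚᵘ
open import Data.Sum.Base using (inj₁; inj₂)
open import Relation.Binary.PropositionalEquality
  using (_≡_; refl; sym; trans; cong; cong₂; subst; subst₂; module ≡-Reasoning)
open import Relation.Nullary using (¬_; contradiction)

-- Integers inside the rationals and clearing of denominators.

fromℚᵘ-homo-+ : ∀ p q → fromℚᵘ p + fromℚᵘ q ≡ fromℚᵘ (p ℚᵘ.+ q)
fromℚᵘ-homo-+ p q = ℚ.toℚᵘ-injective (begin-equality
  toℚᵘ (fromℚᵘ p + fromℚᵘ q)            ≃⟨ ℚ.toℚᵘ-homo-+ (fromℚᵘ p) (fromℚᵘ q) ⟩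
  toℚᵘ (fromℚᵘ p) ℚᵘ.+ toℚᵘ (fromℚᵘ q)  ≃⟨ ℚᵘ.+-cong (ℚ.toℚᵘ-fromℚᵘ p) (ℚ.toℚᵘ-fromℚᵘ q) ⟩
  p ℚᵘ.+ q                              ≃⟨ ℚ.toℚᵘ-fromℚᵘ (p ℚᵘ.+ q) ⟨
  toℚᵘ (fromℚᵘ (p ℚᵘ.+ q))              ∎)
  where open ℚᵘ.≤-Reasoning

fromℚᵘ-homo-* : ∀ p q → fromℚᵘ p * fromℚᵘ q ≡ fromℚᵘ (p ℚᵘ.* q)
fromℚᵘ-homo-* p q = ℚ.toℚᵘ-injective (begin-equality
  toℚᵘ (fromℚᵘ p * fromℚᵘ q)            ≃⟨ ℚ.toℚᵘ-homo-* (fromℚᵘ p) (fromℚᵘ q) ⟩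
  toℚᵘ (fromℚᵘ p) ℚᵘ.* toℚᵘ (fromℚᵘ q)  ≃⟨ ℚᵘ.*-cong (ℚ.toℚᵘ-fromℚᵘ p) (ℚ.toℚᵘ-fromℚᵘ q) ⟩
  p ℚᵘ.* q                              ≃⟨ ℚ.toℚᵘ-fromℚᵘ (p ℚᵘ.* q) ⟨
  toℚᵘ (fromℚᵘ (p ℚᵘ.* q))              ∎)
  where open ℚᵘ.≤-Reasoning

/1-homo-+ : ∀ i j → i / 1 + j / 1 ≡ (i ℤ.+ j) / 1
/1-homo-+ i j = trans (fromℚᵘ-homo-+ (mkℚᵘ i 0) (mkℚᵘ j 0))
  (cong (_/ 1) (cong₂ ℤ._+_ (ℤ.*-identityʳ i) (ℤ.*-identityʳ j)))

/1-homo-* : ∀ i j → (i / 1) * (j / 1) ≡ (i ℤ.* j) / 1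
/1-homo-* i j = fromℚᵘ-homo-* (mkℚᵘ i 0) (mkℚᵘ j 0)

/1-mono-≤ : ∀ {i j} → i ℤ.≤ j → i / 1 ℚ.≤ j / 1
/1-mono-≤ {i} {j} i≤j = ℚ.toℚᵘ-cancel-≤ (begin
  toℚᵘ (i / 1)  ≃⟨ ℚ.toℚᵘ-fromℚᵘ (mkℚᵘ i 0) ⟩
  mkℚᵘ i 0      ≤⟨ *≤* (ℤ.*-monoʳ-≤-nonNeg (+ 1) i≤j) ⟩
  mkℚᵘ j 0      ≃⟨ ℚ.toℚᵘ-fromℚᵘ (mkℚᵘ j 0) ⟨
  toℚᵘ (j / 1)  ∎)
  where open ℚᵘ.≤-Reasoning

/1-cancel-< : ∀ {i j} → i / 1 ℚ.< j / 1 → i ℤ.< j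
/1-cancel-< i<j = ℤ.≰⇒> λ j≤i → ℚ.<-irrefl refl (ℚ.<-≤-trans i<j (/1-mono-≤ j≤i))

/1-cancel-≤ : ∀ {i j} → i / 1 ℚ.≤ j / 1 → i ℤ.≤ j
/1-cancel-≤ {i} {j} i≤j = subst₂ ℤ._≤_ (ℤ.*-identityʳ i) (ℤ.*-identityʳ j)
  (ℚᵘ.drop-*≤* (ℚᵘ.≤-respˡ-≃ (ℚ.toℚᵘ-fromℚᵘ (mkℚᵘ i 0))
    (ℚᵘ.≤-respʳ-≃ (ℚ.toℚᵘ-fromℚᵘ (mkℚᵘ j 0)) (ℚ.toℚᵘ-mono-≤ i≤j))))

-- Discreteness of the integers, carried over to `ℚ`: this is what turns strict positivity of an
-- integral difference into a lower bound independent of its size.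
/1-gap : ∀ i j → i / 1 ℚ.< j / 1 → 1ℚ ℚ.≤ j / 1 - i / 1
/1-gap i j i<j = begin
  1ℚ                        ≡⟨ p≡p+q-q 1ℚ (i / 1) ⟩
  1ℚ + i / 1 - i / 1        ≡⟨ cong (_- i / 1) (/1-homo-+ (+ 1) i) ⟩
  (+ 1 ℤ.+ i) / 1 - i / 1   ≤⟨ ℚ.+-monoˡ-≤ (- (i / 1)) (/1-mono-≤ {+ 1 ℤ.+ i} {j}
                                 (ℤ.i<j⇒suc[i]≤j (/1-cancel-< {i} {j} i<j))) ⟩
  j / 1 - i / 1             ∎
  where
  open ℚ.≤-Reasoning
  p≡p+q-q : ∀ p q → p ≡ p + q - q
  p≡p+q-q = solve 2 (λ p q → p := p :+ q :- q) refl
    where open ℚ.+-*-Solver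

/1-injective : ∀ {i j} → i / 1 ≡ j / 1 → i ≡ j
/1-injective i≡j = ℤ.≤-antisym
  (/1-cancel-≤ (ℚ.≤-reflexive i≡j)) (/1-cancel-≤ (ℚ.≤-reflexive (sym i≡j)))

-- `_/_` reduces to lowest terms, so the identity is checked by cross-multiplication on unnormalised
-- fractions. Later comparisons of reciprocals multiply through by a denominator and apply it.
/-*-cancel : ∀ i d .{{_ : NonZero d}} → (i / d) * (+ d / 1) ≡ i / 1
/-*-cancel i d@(suc d-1) = trans (fromℚᵘ-homo-* (mkℚᵘ i d-1) (mkℚᵘ (+ d) 0))
  (ℚ.fromℚᵘ-cong {mkℚᵘ (i ℤ.* + d) (d-1 ℕ.* 1)} {mkℚᵘ i 0} (*≡* (trans (ℤ.*-identityʳ _)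
    (cong (λ n → i ℤ.* + n) (sym (ℕ.*-identityʳ d))))))

infix 8 ι_
ι_ : ℕ → ℚ
ι n = + n / 1

ι-* : ∀ m n → ι m * ι n ≡ ι (m ℕ.* n)
ι-* m n = trans (/1-homo-* (+ m) (+ n)) (cong (_/ 1) (sym (ℤ.pos-* m n)))

ι-mono-≤ : ∀ {m n} → m ≤ n → ι m ℚ.≤ ι n
ι-mono-≤ m≤n = /1-mono-≤ (ℤ.+≤+ m≤n)

ι-cancel-≤ : ∀ {m n} → ι m ℚ.≤ ι n → m ≤ n
ι-cancel-≤ m≤n = ℤ.drop‿+≤+ (/1-cancel-≤ m≤n)

ι-nonNeg : ∀ n → ℚ.NonNegative (ι n)
ι-nonNeg n = ℚ.normalize-nonNeg n 1

ι-pos : ∀ n .{{_ : NonZero n}} → ℚ.Positive (ι n)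
ι-pos n = ℚ.normalize-pos n 1

*ι-mono-≤ : ∀ n {p q} → p ℚ.≤ q → p * ι n ℚ.≤ q * ι n
*ι-mono-≤ n = ℚ.*-monoʳ-≤-nonNeg (ι n) {{ι-nonNeg n}}

*ι-cancel-≤ : ∀ n .{{_ : NonZero n}} {p q} → p * ι n ℚ.≤ q * ι n → p ℚ.≤ q
*ι-cancel-≤ n = ℚ.*-cancelʳ-≤-pos (ι n) {{ι-pos n}}

*ι*ι : ∀ p m n → p * ι m * ι n ≡ p * ι (m ℕ.* n)
*ι*ι p m n = trans (ℚ.*-assoc p (ι m) (ι n)) (cong (p *_) (ι-* m n))

1/n-antimono : ∀ m n .{{_ : NonZero m}} .{{_ : NonZero n}} → m ≤ n → + 1 / n ℚ.≤ + 1 / m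
1/n-antimono m n m≤n = *ι-cancel-≤ m (begin
  (+ 1 / n) * ι m  ≤⟨ ℚ.*-monoˡ-≤-nonNeg (+ 1 / n) {{ℚ.normalize-nonNeg 1 n}} (ι-mono-≤ m≤n) ⟩
  (+ 1 / n) * ι n  ≡⟨ /-*-cancel (+ 1) n ⟩
  ι 1              ≡⟨ /-*-cancel (+ 1) m ⟨
  (+ 1 / m) * ι m  ∎)
  where open ℚ.≤-Reasoning

0<1/n : ∀ n .{{_ : NonZero n}} → 0ℚ ℚ.< + 1 / n
0<1/n n = ℚ.positive⁻¹ (+ 1 / n) {{ℚ.normalize-pos 1 n}}

-- Differences and absolute values in `ℚ`.

p<q⇒0<q-p : ∀ {p q} → p ℚ.< q → 0ℚ ℚ.< q - p
p<q⇒0<q-p {p} {q} p<q = subst (ℚ._< q - p) (ℚ.+-inverseʳ p) (ℚ.+-monoˡ-< (- p) p<q)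

neg-[p-q] : ∀ p q → - (p - q) ≡ q - p
neg-[p-q] = solve 2 (λ p q → :- (p :- q) := q :- p) refl
  where open ℚ.+-*-Solver

p≤∣p∣ : ∀ p → p ℚ.≤ ∣ p ∣
p≤∣p∣ p with ℚ.≤-total 0ℚ p
... | inj₁ 0≤p = ℚ.≤-reflexive (sym (ℚ.0≤p⇒∣p∣≡p 0≤p))
... | inj₂ p≤0 = ℚ.≤-trans p≤0 (ℚ.0≤∣p∣ p)

-p≤∣p∣ : ∀ p → - p ℚ.≤ ∣ p ∣
-p≤∣p∣ p = subst (- p ℚ.≤_) (ℚ.∣-p∣≡∣p∣ p) (p≤∣p∣ (- p))

p≤q+r⇒p-q≤r : ∀ {p q r} → p ℚ.≤ q + r → p - q ℚ.≤ r
p≤q+r⇒p-q≤r {p} {q} {r} p≤q+r = subst (p - q ℚ.≤_)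
  (solve 2 (λ q r → q :+ r :- q := r) refl q r) (ℚ.+-monoˡ-≤ (- q) p≤q+r)
  where open ℚ.+-*-Solver

∣p-q∣≤r : ∀ {p q r} → p ℚ.≤ q + r → q ℚ.≤ p + r → ∣ p - q ∣ ℚ.≤ r
∣p-q∣≤r {p} {q} {r} p≤q+r q≤p+r with ℚ.∣p∣≡p∨∣p∣≡-p (p - q)
... | inj₁ e = subst (ℚ._≤ r) (sym e) (p≤q+r⇒p-q≤r p≤q+r)
... | inj₂ e = subst (ℚ._≤ r) (sym (trans e (neg-[p-q] p q))) (p≤q+r⇒p-q≤r q≤p+r)

-- Factorials against exponentials.

n≤n! : ∀ n → n ≤ n !
n≤n! zero    = z≤n
n≤n! (suc n) = ℕ.m≤m*n (suc n) (n !) {{n ℕ.!≢0}}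

n<2^n : ∀ n → n ℕ.< 2 ^ n
n<2^n zero    = s≤s z≤n
n<2^n (suc n) = begin-strict
  suc n          ≤⟨ n<2^n n ⟩
  2 ^ n          <⟨ ℕ.^-monoʳ-< 2 (s≤s (s≤s z≤n)) (ℕ.n<1+n n) ⟩
  2 ^ suc n      ∎
  where open ℕ.≤-Reasoning

-- The top `n` factors of the factorial are all at least `m`.
m^n≤[n+m]! : ∀ m n → m ^ n ≤ (n ℕ.+ m) !
m^n≤[n+m]! m zero    = ℕ.1≤n! m
m^n≤[n+m]! m (suc n) = ℕ.*-mono-≤ (ℕ.m≤n+m m (suc n)) (m^n≤[n+m]! m n)

^-distribʳ-* : ∀ m n o → (m ℕ.* n) ^ o ≡ m ^ o ℕ.* n ^ o
^-distribʳ-* m n zero    = refl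
^-distribʳ-* m n (suc o) = begin
  m ℕ.* n ℕ.* (m ℕ.* n) ^ o         ≡⟨ cong (m ℕ.* n ℕ.*_) (^-distribʳ-* m n o) ⟩
  m ℕ.* n ℕ.* (m ^ o ℕ.* n ^ o)     ≡⟨ solve 4 (λ a b c d → a :* b :* (c :* d) := a :* c :* (b :* d))
                                          refl m n (m ^ o) (n ^ o) ⟩
  m ^ suc o ℕ.* n ^ suc o           ∎
  where
  open ≡-Reasoning
  open +-*-Solver

-- With `k = 2b` and exponent `j + k`, the constant part of `c * b ^ (j + k)` is `c * b ^ k`.
-- Choosing `j` equal to that constant lets `j < 2 ^ j` absorb it, and the resulting `(2b) ^ j` is
-- at most `(j + k) !`.
!-outgrows-^ : ∀ c b .{{_ : NonZero b}} → ∃[ n ] (c ℕ.* b ^ n ℕ.< n !)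
!-outgrows-^ c b = j ℕ.+ k , (begin-strict
  c ℕ.* b ^ (j ℕ.+ k)         ≡⟨ cong (c ℕ.*_) (ℕ.^-distribˡ-+-* b j k) ⟩
  c ℕ.* (b ^ j ℕ.* b ^ k)     ≡⟨ solve 3 (λ x y z → x :* (y :* z) := x :* z :* y) refl c (b ^ j) (b ^ k) ⟩
  j ℕ.* b ^ j                 <⟨ ℕ.*-monoˡ-< (b ^ j) {{ℕ.m^n≢0 b j}} (n<2^n j) ⟩
  2 ^ j ℕ.* b ^ j             ≡⟨ ^-distribʳ-* 2 b j ⟨
  k ^ j                       ≤⟨ m^n≤[n+m]! k j ⟩
  (j ℕ.+ k) !                 ∎)
  where
  open ℕ.≤-Reasoning
  open +-*-Solver
  k j : ℕ
  k = 2 ℕ.* b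
  j = c ℕ.* b ^ k

-- Limits of Cauchy sequences.

Cauchy⇒fromℚ-converges : ∀ x → (λ n → fromℚ (seq x n)) ConvergesTo x
Cauchy⇒fromℚ-converges x ε 0<ε =
  let N , close = cauchy x (ε * ½) 0<ε/2
  -- One half of `ε` bounds the distance between terms; the other half is the positive gap that
  -- `_<ʳ_` demands.
  in N , λ n N≤n → ε * ½ , 0<ε/2 , N , λ m N≤m →
    ℚ.≤-trans (ℚ.+-monoˡ-≤ (ε * ½) (ℚ.<⇒≤ (close n m N≤n N≤m))) (ℚ.≤-reflexive ε/2+ε/2≡ε)
  where
  0<ε/2 : 0ℚ ℚ.< ε * ½
  0<ε/2 = subst (ℚ._< ε * ½) (ℚ.*-zeroˡ ½) (ℚ.*-monoˡ-<-pos ½ 0<ε)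

  ε/2+ε/2≡ε : ε * ½ + ε * ½ ≡ ε
  ε/2+ε/2≡ε = trans (sym (ℚ.*-distribˡ-+ ε ½ ½)) (ℚ.*-identityʳ ε)

-- If `q < c`, then `c - q` is an admissible tolerance, yet all late terms stay at least that far
-- above `q`.
limit-≥ : ∀ {x q c} n → x ≃ fromℚ q → (∀ m → n ≤ m → c ℚ.≤ seq x m) → c ℚ.≤ q
limit-≥ {x} {q} {c} n x≃q c≤x = ℚ.≮⇒≥ λ q<c →
  let N , close = x≃q (c - q) (p<q⇒0<q-p q<c)
      m = n ℕ.+ N
  in ℚ.<-irrefl refl (ℚ.≤-<-trans
    (ℚ.≤-trans (ℚ.+-monoˡ-≤ (- q) (c≤x m (ℕ.m≤m+n n N))) (p≤∣p∣ (seq x m - q)))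
    (close m (ℕ.m≤n+m N n)))

limit-≤ : ∀ {x q c} n → x ≃ fromℚ q → (∀ m → n ≤ m → seq x m ℚ.≤ c) → q ℚ.≤ c
limit-≤ {x} {q} {c} n x≃q x≤c = ℚ.≮⇒≥ λ c<q →
  let N , close = x≃q (q - c) (p<q⇒0<q-p c<q)
      m = n ℕ.+ N
  in ℚ.<-irrefl refl (ℚ.≤-<-trans
    (ℚ.≤-trans (ℚ.+-monoʳ-≤ q (ℚ.neg-antimono-≤ (x≤c m (ℕ.m≤m+n n N))))
      (subst (ℚ._≤ ∣ seq x m - q ∣) (neg-[p-q] (seq x m) q) (-p≤∣p∣ (seq x m - q))))
    (close m (ℕ.m≤n+m N n)))

-- Reciprocals of factorials.

1/! : ℕ → ℚ
1/! n = (+ 1 / n !) {{n ℕ.!≢0}}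

-- After multiplication by `suc n !` this is `2 ≤ suc n`, hence the nonzero `n`. It makes the upper
-- bounds `U` below decrease.
1/!-double : ∀ n .{{_ : NonZero n}} → 1/! (suc n) + 1/! (suc n) ℚ.≤ 1/! n
1/!-double n = *ι-cancel-≤ (suc n !) {{suc n ℕ.!≢0}} (begin
  (w′ + w′) * ι (suc n !)          ≡⟨ ℚ.*-distribʳ-+ (ι (suc n !)) w′ w′ ⟩
  w′ * ι (suc n !) + w′ * ι (suc n !)
    ≡⟨ cong (λ x → x + x) (/-*-cancel (+ 1) (suc n !) {{suc n ℕ.!≢0}}) ⟩
  ι 2                              ≤⟨ ι-mono-≤ (s≤s (ℕ.>-nonZero⁻¹ n)) ⟩
  ι (suc n)                        ≡⟨ ℚ.*-identityˡ (ι (suc n)) ⟨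
  ι 1 * ι (suc n)                  ≡⟨ cong (_* ι (suc n)) (/-*-cancel (+ 1) (n !) {{n ℕ.!≢0}}) ⟨
  1/! n * ι (n !) * ι (suc n)      ≡⟨ *ι*ι (1/! n) (n !) (suc n) ⟩
  1/! n * ι (n ! ℕ.* suc n)        ≡⟨ cong (λ k → 1/! n * ι k) (ℕ.*-comm (n !) (suc n)) ⟩
  1/! n * ι (suc n !)              ∎)
  where
  open ℚ.≤-Reasoning
  w′ : ℚ
  w′ = 1/! (suc n)

-- The denominator of `ε` serves: multiplying by it leaves the numerator, a positive integer.
archimedean : ∀ ε → 0ℚ ℚ.< ε → ∃[ n ] (NonZero n × 1ℚ ℚ.≤ ε * ι n)
archimedean ε@(mkℚ n d _) 0<ε = suc d , _ ,
  subst (1ℚ ℚ.≤_) (trans (sym (/-*-cancel n (suc d))) (cong (_* ι (suc d)) (ℚ.↥p/↧p≡p ε)))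
    (/1-mono-≤ (0<n (ℚ.positive 0<ε)))
  where
  0<n : ℚ.Positive ε → + 1 ℤ.≤ n
  0<n pos = ℤ.i<j⇒suc[i]≤j (ℤ.positive⁻¹ n {{pos}})

1/!-vanishes : ∀ ε → 0ℚ ℚ.< ε → ∃[ n ] (NonZero n × 1/! n + 1/! n ℚ.< ε)
1/!-vanishes ε 0<ε =
  let d , d≢0 , 1≤εd = archimedean ε 0<ε
      -- The factor 3 leaves room for strictness: `2 < 3 ≤ ε * n ≤ ε * n !`.
      n = d ℕ.* 3
      w = 1/! n
      instance n!≢0 = n ℕ.!≢0
  in n , ℕ.m*n≢0 d 3 {{d≢0}} , ℚ.*-cancelʳ-<-nonNeg (ι (n !)) {{ι-nonNeg (n !)}} (begin-strict
    (w + w) * ι (n !)          ≡⟨ ℚ.*-distribʳ-+ (ι (n !)) w w ⟩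
    w * ι (n !) + w * ι (n !)  ≡⟨ cong (λ x → x + x) (/-*-cancel (+ 1) (n !)) ⟩
    ι 2                        <⟨ ℚ.*<* (ℤ.+<+ (s≤s (s≤s (s≤s z≤n)))) ⟩
    ι 3                        ≡⟨ ℚ.*-identityˡ (ι 3) ⟨
    1ℚ * ι 3                   ≤⟨ *ι-mono-≤ 3 1≤εd ⟩
    ε * ι d * ι 3              ≡⟨ *ι*ι ε d 3 ⟩
    ε * ι n                    ≤⟨ ℚ.*-monoˡ-≤-nonNeg ε {{ℚ.pos⇒nonNeg ε {{ℚ.positive 0<ε}}}}
                                    (ι-mono-≤ (n≤n! n)) ⟩
    ε * ι (n !)                ∎)
  where open ℚ.≤-Reasoning

-- Convergence of the reciprocal series of a divisibility chain.

module ReciprocalSeries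
  (g : ℕ → ℕ) (g≢0 : ∀ n → NonZero (g n))
  (g-∣ : ∀ {m n} → m ≤ n → g m ∣ g n)
  (!≤g : ∀ n → n ! ≤ g n)
  where

  t : ℕ → ℚ
  t n = (+ 1 / g n) {{g≢0 n}}

  S : ℕ → ℚ
  S = partialSum t

  -- Upper ends of nested intervals from `S n` to `U n`, of width `2 / n !`, for `n ≥ 1`. They give
  -- both the Cauchy property and the tail estimate.
  U : ℕ → ℚ
  U n = S n + (1/! n + 1/! n)

  t*ι : ∀ n → t n * ι (g n) ≡ 1ℚ
  t*ι n = /-*-cancel (+ 1) (g n) {{g≢0 n}}

  S<S-suc : ∀ n → S n ℚ.< S (suc n)
  S<S-suc n = subst (ℚ._< S (suc n)) (ℚ.+-identityʳ (S n)) (ℚ.+-monoʳ-< (S n) (0<1/n (g n) {{g≢0 n}}))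

  S-mono : ∀ {m n} → m ℕ.≤′ n → S m ℚ.≤ S n
  S-mono ℕ.≤′-refl           = ℚ.≤-refl
  S-mono (ℕ.≤′-step {n} m≤n) = ℚ.≤-trans (S-mono m≤n) (ℚ.<⇒≤ (S<S-suc n))

  -- The new term `t n` and the new margin `2 / (n + 1)!` are each at most `1 / n !`, so together
  -- they fit into the old margin.
  U-suc≤U : ∀ n .{{_ : NonZero n}} → U (suc n) ℚ.≤ U n
  U-suc≤U n = begin
    S n + t n + (1/! (suc n) + 1/! (suc n))
      ≤⟨ ℚ.+-mono-≤ (ℚ.+-monoʳ-≤ (S n) (1/n-antimono (n !) (g n) {{n ℕ.!≢0}} {{g≢0 n}} (!≤g n)))
                    (1/!-double n) ⟩
    S n + 1/! n + 1/! n    ≡⟨ ℚ.+-assoc (S n) (1/! n) (1/! n) ⟩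
    U n                    ∎
    where open ℚ.≤-Reasoning

  U-antimono : ∀ {m n} → .{{_ : NonZero m}} → m ℕ.≤′ n → U n ℚ.≤ U m
  U-antimono ℕ.≤′-refl = ℚ.≤-refl
  U-antimono {m@(suc _)} (ℕ.≤′-step {n} m≤n) =
    ℚ.≤-trans (U-suc≤U n {{ℕ.>-nonZero (ℕ.≤-trans (s≤s z≤n) (ℕ.≤′⇒≤ m≤n))}}) (U-antimono m≤n)

  S≤U : ∀ {m n} .{{_ : NonZero m}} → m ≤ n → S n ℚ.≤ U m
  S≤U {m} {n} m≤n = begin
    S n          ≡⟨ ℚ.+-identityʳ (S n) ⟨
    S n + 0ℚ     ≤⟨ ℚ.+-monoʳ-≤ (S n) (ℚ.<⇒≤ (ℚ.+-mono-< 0<w 0<w)) ⟩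
    U n          ≤⟨ U-antimono (ℕ.≤⇒≤′ m≤n) ⟩
    U m          ∎
    where
    open ℚ.≤-Reasoning
    0<w : 0ℚ ℚ.< 1/! n
    0<w = 0<1/n (n !) {{n ℕ.!≢0}}

  -- From index `N` on, all partial sums lie between `S N` and `U N`, so any two differ by at most
  -- `2 / N !`.
  S-cauchy : IsCauchy S
  S-cauchy ε 0<ε =
    let N , N≢0 , 2w<ε = 1/!-vanishes ε 0<ε
        close = λ {m} {n} N≤m N≤n → ℚ.≤-trans (S≤U {N} {m} {{N≢0}} N≤m)
                  (ℚ.+-monoˡ-≤ (1/! N + 1/! N) (S-mono {N} {n} (ℕ.≤⇒≤′ N≤n)))
    in N , λ m n N≤m N≤n → ℚ.≤-<-trans (∣p-q∣≤r (close N≤m N≤n) (close N≤n N≤m)) 2w<ε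

  sum : ℝ
  sum = mkℝ S S-cauchy

  -- `S m` contains only the terms below `m`, so the denominators are among `g 0, ..., g n`, all of
  -- which divide `g n`; this is why `m` may reach `suc n`.
  S*ι-integral : ∀ {m} n → m ≤ suc n → ∃[ k ] (S m * ι (g n) ≡ ι k)
  S*ι-integral {zero}  n _ = 0 , ℚ.*-zeroˡ (ι (g n))
  S*ι-integral {suc m} n (s≤s m≤n) with S*ι-integral {m} n (ℕ.m≤n⇒m≤1+n m≤n) | g-∣ m≤n
  ... | k , Sm≡k | divides c gn≡c*gm = k ℕ.+ c , (begin
    (S m + t m) * ι (g n)            ≡⟨ ℚ.*-distribʳ-+ (ι (g n)) (S m) (t m) ⟩
    S m * ι (g n) + t m * ι (g n)    ≡⟨ cong₂ _+_ Sm≡k (cong (λ j → t m * ι j)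
                                          (trans gn≡c*gm (ℕ.*-comm c (g m)))) ⟩
    ι k + t m * ι (g m ℕ.* c)        ≡⟨ cong (λ x → ι k + x) (*ι*ι (t m) (g m) c) ⟨
    ι k + t m * ι (g m) * ι c        ≡⟨ cong (λ x → ι k + x * ι c) (t*ι m) ⟩
    ι k + 1ℚ * ι c                   ≡⟨ cong (λ x → ι k + x) (ℚ.*-identityˡ (ι c)) ⟩
    ι k + ι c                        ≡⟨ /1-homo-+ (+ k) (+ c) ⟩
    ι (k ℕ.+ c)                      ∎)
    where open ≡-Reasoning

  -- Tails of the series under the assumption of a rational sum.

  module _ (q : ℚ) (sum≃q : sum ≃ fromℚ q) where

    b : ℕ
    b = ↧ₙ q

    R : ℕ → ℚ
    R n = q - S n

    -- Strict because the next partial sum is already larger and is itself bounded by the limit.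
    S<q : ∀ n → S n ℚ.< q
    S<q n = ℚ.<-≤-trans (S<S-suc n)
      (limit-≥ {sum} (suc n) sum≃q (λ m n<m → S-mono (ℕ.≤⇒≤′ n<m)))

    R≤ : ∀ n .{{_ : NonZero n}} → R n ℚ.≤ 1/! n + 1/! n
    R≤ n = p≤q+r⇒p-q≤r (limit-≤ {sum} n sum≃q (λ m n≤m → S≤U n≤m))

    -- Multiplying by `g n * b` makes both numbers integers: `b` clears the denominator of `q`, and
    -- `g n` clears those of `S (suc n)`. Their difference is positive, so `/1-gap` applies.
    1≤R-suc*ι-from : ∀ n k → S (suc n) * ι (g n) ≡ ι k → 1ℚ ℚ.≤ R (suc n) * ι (g n ℕ.* b)
    1≤R-suc*ι-from n k S≡k = begin
      1ℚ                       ≤⟨ /1-gap (+ (k ℕ.* b)) (↥ q ℤ.* + g n) (subst₂ ℚ._<_ SX qX S<q*X) ⟩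
      (↥ q ℤ.* + g n) / 1 - ι (k ℕ.* b)
                               ≡⟨ cong₂ _-_ qX SX ⟨
      q * X - S (suc n) * X    ≡⟨ solve 3 (λ q s x → q :* x :- s :* x := (q :- s) :* x)
                                    refl q (S (suc n)) X ⟩
      R (suc n) * X            ∎
      where
      open ℚ.≤-Reasoning
      open ℚ.+-*-Solver
      X = ι (g n ℕ.* b)

      SX : S (suc n) * X ≡ ι (k ℕ.* b)
      SX = trans (sym (*ι*ι (S (suc n)) (g n) b)) (trans (cong (_* ι b) S≡k) (ι-* k b))

      qX : q * X ≡ (↥ q ℤ.* + g n) / 1
      qX = trans (cong (λ j → q * ι j) (ℕ.*-comm (g n) b)) (trans (sym (*ι*ι q b (g n)))
        (trans (cong (_* ι (g n)) (trans (cong (_* ι b) (sym (ℚ.↥p/↧p≡p q))) (/-*-cancel (↥ q) b)))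
          (/1-homo-* (↥ q) (+ g n))))

      S<q*X : S (suc n) * X ℚ.< q * X
      S<q*X = ℚ.*-monoˡ-<-pos X
        {{ι-pos (g n ℕ.* b) {{ℕ.m*n≢0 (g n) b {{g≢0 n}}}}}} (S<q (suc n))

    1≤R-suc*ι : ∀ n → 1ℚ ℚ.≤ R (suc n) * ι (g n ℕ.* b)
    1≤R-suc*ι n = let k , S≡k = S*ι-integral n ℕ.≤-refl in 1≤R-suc*ι-from n k S≡k

    -- The factor `g n` cancels between `t n` and `1≤R-suc*ι`, giving `t n ≤ R (suc n) * ι b`: a
    -- ratio bound that is uniform in `n`, however fast `g` grows.
    R≤R-suc*ι : ∀ n → R n ℚ.≤ R (suc n) * ι (suc b)
    R≤R-suc*ι n = begin
      R n                              ≡⟨ solve 3 (λ q s t → q :- s := q :- (s :+ t) :+ t) refl q (S n) (t n) ⟩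
      R (suc n) + t n                  ≤⟨ ℚ.+-monoʳ-≤ (R (suc n)) (*ι-cancel-≤ (g n) {{g≢0 n}} (begin
          t n * ι (g n)                  ≡⟨ t*ι n ⟩
          1ℚ                             ≤⟨ 1≤R-suc*ι n ⟩
          R (suc n) * ι (g n ℕ.* b)      ≡⟨ cong (λ j → R (suc n) * ι j) (ℕ.*-comm (g n) b) ⟩
          R (suc n) * ι (b ℕ.* g n)      ≡⟨ *ι*ι (R (suc n)) b (g n) ⟨
          R (suc n) * ι b * ι (g n)      ∎)) ⟩
      R (suc n) + R (suc n) * ι b      ≡⟨ solve 2 (λ r x → r :+ r :* x := r :* (con 1ℚ :+ x)) refl
                                            (R (suc n)) (ι b) ⟩
      R (suc n) * (ι 1 + ι b)          ≡⟨ cong (R (suc n) *_) (/1-homo-+ (+ 1) (+ b)) ⟩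
      R (suc n) * ι (suc b)            ∎
      where
      open ℚ.≤-Reasoning
      open ℚ.+-*-Solver

    c : ℕ
    c = g 0 ℕ.* b

    -- Iterates the ratio bound starting from `R 1`, where integrality gives the constant
    -- `c = g 0 * b`.
    1≤R*ι : ∀ n → 1ℚ ℚ.≤ R (suc n) * ι (c ℕ.* suc b ^ n)
    1≤R*ι zero    = subst (λ j → 1ℚ ℚ.≤ R 1 * ι j) (sym (ℕ.*-identityʳ c)) (1≤R-suc*ι 0)
    1≤R*ι (suc n) = begin
      1ℚ                                                  ≤⟨ 1≤R*ι n ⟩
      R (suc n) * ι (c ℕ.* suc b ^ n)                     ≤⟨ *ι-mono-≤ (c ℕ.* suc b ^ n) (R≤R-suc*ι (suc n)) ⟩
      R (2 ℕ.+ n) * ι (suc b) * ι (c ℕ.* suc b ^ n)       ≡⟨ *ι*ι (R (2 ℕ.+ n)) (suc b) (c ℕ.* suc b ^ n) ⟩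
      R (2 ℕ.+ n) * ι (suc b ℕ.* (c ℕ.* suc b ^ n))       ≡⟨ cong (λ j → R (2 ℕ.+ n) * ι j)
        (solve 3 (λ x y z → x :* (y :* z) := y :* (x :* z)) refl (suc b) c (suc b ^ n)) ⟩
      R (2 ℕ.+ n) * ι (c ℕ.* suc b ^ suc n)               ∎
      where
      open ℚ.≤-Reasoning
      open +-*-Solver

    -- The geometric lower bound and the factorial upper bound on `R (suc n)` are compared: with
    -- `C = c * suc b ^ n`, `1 ≤ R (suc n) * C ≤ 2 * C / (n + 1)!`.
    !≤exponential : ∀ n → suc n ! ≤ 2 ℕ.* c ℕ.* suc b ^ n
    !≤exponential n = ι-cancel-≤ (begin
      ι F                        ≡⟨ ℚ.*-identityˡ (ι F) ⟨
      1ℚ * ι F                   ≤⟨ *ι-mono-≤ F (1≤R*ι n) ⟩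
      R (suc n) * ι C * ι F      ≤⟨ *ι-mono-≤ F (*ι-mono-≤ C (R≤ (suc n))) ⟩
      (w + w) * ι C * ι F        ≡⟨ solve 3 (λ w x y → (w :+ w) :* x :* y := (w :* y :+ w :* y) :* x)
                                      refl w (ι C) (ι F) ⟩
      (w * ι F + w * ι F) * ι C  ≡⟨ cong (λ x → (x + x) * ι C) (/-*-cancel (+ 1) F {{suc n ℕ.!≢0}}) ⟩
      ι 2 * ι C                  ≡⟨ ι-* 2 C ⟩
      ι (2 ℕ.* C)                ≡⟨ cong ι_ (ℕ.*-assoc 2 c (suc b ^ n)) ⟨
      ι (2 ℕ.* c ℕ.* suc b ^ n)  ∎)
      where
      open ℚ.≤-Reasoning
      open ℚ.+-*-Solver
      F = suc n !
      C = c ℕ.* suc b ^ n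
      w = 1/! (suc n)

  sum-irrational : Irrational sum
  sum-irrational (q , sum≃q) =
    let n , exponential<! = !-outgrows-^ (2 ℕ.* c q sum≃q) (suc (b q sum≃q))
    -- `!-outgrows-^` exceeds the exponential with `n !`, which is at most the `suc n !` of
    -- `!≤exponential`.
    in ℕ.<⇒≱ (ℕ.<-≤-trans exponential<! (ℕ.m≤n*m (n !) (suc n))) (!≤exponential q sum≃q n)

  hasIrrationalSum : HasIrrationalSum t
  hasIrrationalSum = sum , Cauchy⇒fromℚ-converges sum , sum-irrational

-- Divisibility for powers, products and abstract factorials.

^-mono-∣ : ∀ {m n} o → m ∣ n → m ^ o ∣ n ^ o
^-mono-∣ zero    m∣n = ℕ.∣-refl
^-mono-∣ (suc o) m∣n = ℕ.*-pres-∣ m∣n (^-mono-∣ o m∣n)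

∏-mono-∣ : ∀ {k} {f h : Fin k → ℕ} → (∀ j → f j ∣ h j) → ∏ f ∣ ∏ h
∏-mono-∣ {zero}  f∣h = ℕ.∣-refl
∏-mono-∣ {suc k} f∣h = ℕ.*-pres-∣ (f∣h zero) (∏-mono-∣ (λ j → f∣h (suc j)))

factor∣∏ : ∀ {k} (f : Fin k → ℕ) j → f j ∣ ∏ f
factor∣∏ f zero    = ℕ.m∣m*n _
factor∣∏ f (suc j) = ℕ.∣n⇒∣m*n (f zero) (factor∣∏ (λ i → f (suc i)) j)

module _ (a : AbstractFactorial) where
  open AbstractFactorial a using (binomial-integral; !-divides)

  -- The cofactor is the integral binomial coefficient times `fac a (n ∸ m)`.
  fac-mono-∣ : ∀ {m n} → m ≤ n → fac a m ∣ fac a n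
  fac-mono-∣ {m} {n} m≤n with binomial-integral n m m≤n
  ... | i , _ , binomial≡i = ℕ.∣-trans (ℕ.m∣m*n (fac a (n ℕ.∸ m))) (divides i (ℤ.+-injective
    (/1-injective (trans (sym (/-*-cancel (+ fac a n) d {{d≢0}}))
      (trans (cong (_* ι d) binomial≡i) (ι-* i d))))))
    where
    d = fac a m ℕ.* fac a (n ℕ.∸ m)
    d≢0 = ℕ.m*n≢0 _ _ {{nonZero a m}} {{nonZero a (n ℕ.∸ m)}}

  !∣fac : ∀ n → n ! ∣ fac a n
  !∣fac zero    = ℕ.1∣ fac a 0
  !∣fac (suc n) = !-divides (suc n) (s≤s z≤n)

theorem28 : (∀ (a : AbstractFactorial) → HasIrrationalSum (reciprocal a))
    × (∀ (k : ℕ) → 1 ≤ k → (a : Fin k → AbstractFactorial) → (s : Fin k → ℕ) → ¬ (∀ j → s j ≡ 0) → HasIrrationalSum (productReciprocal a s))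
theorem28 = single , product
  where
  single : ∀ a → HasIrrationalSum (reciprocal a)
  single a = ReciprocalSeries.hasIrrationalSum (fac a) (nonZero a) (fac-mono-∣ a)
    λ n → ℕ.∣⇒≤ {{nonZero a n}} (!∣fac a n)

  product : ∀ k → 1 ≤ k → (a : Fin k → AbstractFactorial) (s : Fin k → ℕ) →
            ¬ (∀ j → s j ≡ 0) → HasIrrationalSum (productReciprocal a s)
  -- Equality with zero is decidable and `Fin k` is finite, so the negated universal statement
  -- yields an actual index with nonzero exponent.
  product k _ a s s≢0 with ¬∀⟶∃¬ k (λ j → s j ≡ 0) (λ j → s j ℕ.≟ 0) s≢0
  ... | j , sⱼ≢0 = ReciprocalSeries.hasIrrationalSum P P≢0
    (λ m≤n → ∏-mono-∣ (λ i → ^-mono-∣ (s i) (fac-mono-∣ (a i) m≤n)))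
    -- `n !` divides `fac (a j) n`, which divides its own power since `s j` is nonzero, and that
    -- power is a factor of the product.
    (λ n → ℕ.∣⇒≤ {{P≢0 n}} (ℕ.∣-trans (!∣fac (a j) n)
      (ℕ.∣-trans (m∣m^n (s j) sⱼ≢0) (factor∣∏ (λ i → fac (a i) n ^ s i) j))))
    where
    P : ℕ → ℕ
    P n = ∏ (λ i → fac (a i) n ^ s i)

    P≢0 : ∀ n → NonZero (P n)
    P≢0 n = ∏-nonZero _ (λ i → ℕ.m^n≢0 (fac (a i) n) (s i) {{nonZero (a i) n}})

    m∣m^n : ∀ {m} n → ¬ n ≡ 0 → m ∣ m ^ n
    m∣m^n zero    n≢0 = contradiction refl n≢0
    m∣m^n (suc n) _   = ℕ.m∣m*n _
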